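{- Let $n$ be any positive integer. Then for $2\le k\le n$, $$B_{n,k}(1!u_1,2!u_2,\ldots,(n-k+1)!u_{n-k+1})=\sum_{j=0}^{n-k}(j+1)(n-1)_j\,u_{j+1}\,B_{n-j-1,k-1}(1!u_1,2!u_2,\ldots,(n-j-k+1)!u_{n-j-k+1}).$$ Alternatively, for $2\le k\le n-1$, $$B_{n,k}(1!u_1,2!u_2,\ldots,(n-k+1)!u_{n-k+1})=u_1B_{n-1,k-1}(1!u_1,2!u_2,\ldots,(n-k+1)!u_{n-k+1})+\sum_{j=1}^{n-k}(j+1)u_{j+1}\frac{\partial}{\partial u_j}B_{n-1,k}(1!u_1,2!u_2,\ldots,(n-k)!u_{n-k}).$$
   Context: $(m)_j=m(m-1)\cdots(m-j+1)$ denotes the falling factorial, with $(m)_0=1$. For integers $1\le k\le n$, the partial exponential Bell polynomial is $$B_{n,k}(x_1,\ldots,x_{n-k+1})=n!\sum_{\Lambda^k_n}\prod_{j=1}^{n-k+1}\frac{1}{k_j!}\Big(\frac{x_j}{j!}\Big)^{k_j},$$ where the sum is over $\Lambda^k_n=\{(k_1,\ldots,k_{n-k+1}): \sum_j k_j=k,\ \sum_j jk_j=n,\ k_j\in\mathbb{Z}_{\ge 0}\}$. The partial derivative $\partial/\partial u_j$ is taken of the whole expression $B_{n-1,k}(1!u_1,\ldots,(n-k)!u_{n-k})$ as a polynomial in $u_1,u_2,\ldots$. -}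

module Defs where

open import Algebra.Bundles using (CommutativeRing)
open import Algebra.Structures using (IsCommutativeMonoid; IsCommutativeSemiring)
open import Algebra.Structures.Biased using (isCommutativeSemiringˡ)
open import Data.Fin.Base using (toℕ)
open import Data.Integer.Base using (+_)
open import Data.List.Base as List using (List; []; _∷_; foldr; filter; upTo; cartesianProductWith)
open import Data.Nat.Base as ℕ using (ℕ; zero; suc; _∸_; _!)
import Data.Nat.Properties as ℕ
open import Data.Product.Base using (_,_)
open import Data.Rational.Base as ℚ using (ℚ; 0ℚ; 1ℚ)
open import Data.Vec.Base as Vec using (Vec; lookup)
open import Data.Vec.Functional using (Vector)
open import Level using (0ℓ)
open import Relation.Binary.Structures using (IsEquivalence)
open import Relation.Nullary.Decidable using (yes; no; _×-dec_)

-- The polynomial ring ℚ[u 0, u 1, u 2, …], presented as the free commutative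
-- ℚ-algebra on the symbols u j: terms modulo the congruence _≈_ generated by
-- the algebra axioms.  The indeterminate u 0 never occurs in Bell polynomials;
-- it is there only so that u j carries the customary index j ≥ 1.

infixl 6 _+_
infixl 7 _*_
infix  8 -_
infix  4 _≈_

data Poly : Set where
  con : ℚ → Poly
  u   : ℕ → Poly
  _+_ : Poly → Poly → Poly
  _*_ : Poly → Poly → Poly

data _≈_ : Poly → Poly → Set where
  ≈-refl  : ∀ {p} → p ≈ p
  ≈-sym   : ∀ {p q} → p ≈ q → q ≈ p
  ≈-trans : ∀ {p q r} → p ≈ q → q ≈ r → p ≈ r
  +-cong  : ∀ {p p′ q q′} → p ≈ p′ → q ≈ q′ → p + q ≈ p′ + q′
  *-cong  : ∀ {p p′ q q′} → p ≈ p′ → q ≈ q′ → p * q ≈ p′ * q′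
  +-assoc : ∀ p q r → (p + q) + r ≈ p + (q + r)
  +-comm  : ∀ p q → p + q ≈ q + p
  +-idˡ   : ∀ p → con 0ℚ + p ≈ p
  *-assoc : ∀ p q r → (p * q) * r ≈ p * (q * r)
  *-comm  : ∀ p q → p * q ≈ q * p
  *-idˡ   : ∀ p → con 1ℚ * p ≈ p
  *-zeroˡ : ∀ p → con 0ℚ * p ≈ con 0ℚ
  distribʳ : ∀ p q r → (q + r) * p ≈ q * p + r * p
  con-+   : ∀ a b → con (a ℚ.+ b) ≈ con a + con b
  con-*   : ∀ a b → con (a ℚ.* b) ≈ con a * con b

-_ : Poly → Poly
- p = con (ℚ.- 1ℚ) * p

≈-isEquivalence : IsEquivalence _≈_
≈-isEquivalence = record { refl = ≈-refl ; sym = ≈-sym ; trans = ≈-trans }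

private
  isCommutativeMonoid : ∀ {_∙_ : Poly → Poly → Poly} {e} →
    (∀ {p p′ q q′} → p ≈ p′ → q ≈ q′ → (p ∙ q) ≈ (p′ ∙ q′)) →
    (∀ p q r → ((p ∙ q) ∙ r) ≈ (p ∙ (q ∙ r))) →
    (∀ p q → (p ∙ q) ≈ (q ∙ p)) →
    (∀ p → (e ∙ p) ≈ p) →
    IsCommutativeMonoid _≈_ _∙_ e
  isCommutativeMonoid cong assoc comm idˡ = record
    { isMonoid = record
      { isSemigroup = record
        { isMagma = record { isEquivalence = ≈-isEquivalence ; ∙-cong = cong }
        ; assoc   = assoc
        }
      ; identity = idˡ , λ p → ≈-trans (comm p _) (idˡ p)
      }
    ; comm = comm
    }

  isCommutativeSemiring : IsCommutativeSemiring _≈_ _+_ _*_ (con 0ℚ) (con 1ℚ)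
  isCommutativeSemiring = isCommutativeSemiringˡ (record
    { +-isCommutativeMonoid = isCommutativeMonoid +-cong +-assoc +-comm +-idˡ
    ; *-isCommutativeMonoid = isCommutativeMonoid *-cong *-assoc *-comm *-idˡ
    ; distribʳ = distribʳ
    ; zeroˡ    = *-zeroˡ
    })

  module S = IsCommutativeSemiring isCommutativeSemiring

  -‿inverseˡ : ∀ p → - p + p ≈ con 0ℚ
  -‿inverseˡ p =
    ≈-trans (+-cong ≈-refl (≈-sym (*-idˡ p)))
    (≈-trans (≈-sym (distribʳ p (con (ℚ.- 1ℚ)) (con 1ℚ)))
    (≈-trans (*-cong (≈-sym (con-+ (ℚ.- 1ℚ) 1ℚ)) ≈-refl) (*-zeroˡ p)))

polyRing : CommutativeRing 0ℓ 0ℓ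
polyRing = record
  { Carrier = Poly
  ; _≈_ = _≈_
  ; _+_ = _+_
  ; _*_ = _*_
  ; -_  = -_
  ; 0#  = con 0ℚ
  ; 1#  = con 1ℚ
  ; isCommutativeRing = record
    { isRing = record
      { +-isAbelianGroup = record
        { isGroup = record
          { isMonoid = S.+-isMonoid
          ; inverse  = -‿inverseˡ , λ p → ≈-trans (+-comm p (- p)) (-‿inverseˡ p)
          ; ⁻¹-cong  = *-cong ≈-refl
          }
        ; comm = +-comm
        }
      ; *-cong     = *-cong
      ; *-assoc    = *-assoc
      ; *-identity = S.*-identity
      ; distrib    = S.distrib
      }
    ; *-comm = *-comm
    }
  }

open import Algebra.Properties.Semiring.Exp (CommutativeRing.semiring polyRing) public
  using (_^_)
open import Algebra.Properties.CommutativeMonoid.Sum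
  (CommutativeRing.+-commutativeMonoid polyRing) public
  using (sum)
open import Algebra.Properties.CommutativeMonoid.Sum
  (CommutativeRing.*-commutativeMonoid polyRing) public
  using () renaming (sum to product)

∂ : ℕ → Poly → Poly
∂ j (con a) = con 0ℚ
∂ j (u i) with i ℕ.≟ j
... | yes _ = con 1ℚ
... | no  _ = con 0ℚ
∂ j (p + q) = ∂ j p + ∂ j q
∂ j (p * q) = ∂ j p * q + p * ∂ j q

-- ∂ j descends to the quotient by _≈_.
∂-cong : ∀ j {p q} → p ≈ q → ∂ j p ≈ ∂ j q
∂-cong j ≈-refl          = ≈-refl
∂-cong j (≈-sym e)       = ≈-sym (∂-cong j e)
∂-cong j (≈-trans e f)   = ≈-trans (∂-cong j e) (∂-cong j f)
∂-cong j (+-cong e f)    = +-cong (∂-cong j e) (∂-cong j f)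
∂-cong j (*-cong e f)    = +-cong (*-cong (∂-cong j e) f) (*-cong e (∂-cong j f))
∂-cong j (+-assoc p q r) = +-assoc _ _ _
∂-cong j (+-comm p q)    = +-comm _ _
∂-cong j (+-idˡ p)       = +-idˡ _
∂-cong j (*-assoc p q r) =
  ≈-trans (+-cong (≈-trans (distribʳ r _ _) (+-cong (*-assoc _ _ _) (*-assoc _ _ _))) (*-assoc _ _ _))
  (≈-trans (+-assoc _ _ _)
  (+-cong ≈-refl (≈-sym (S.distribˡ p _ _))))
∂-cong j (*-comm p q)    = ≈-trans (+-comm _ _) (+-cong (*-comm _ _) (*-comm _ _))
∂-cong j (*-idˡ p)       = ≈-trans (+-cong (*-zeroˡ p) (*-idˡ _)) (+-idˡ _)
∂-cong j (*-zeroˡ p)     = ≈-trans (+-cong (*-zeroˡ p) (*-zeroˡ _)) (+-idˡ _)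
∂-cong j (distribʳ p q r) =
  ≈-trans (+-cong (distribʳ _ _ _) (distribʳ _ _ _))
  (≈-trans (+-assoc _ _ _)
  (≈-trans (+-cong ≈-refl
     (≈-trans (≈-sym (+-assoc _ _ _))
     (≈-trans (+-cong (+-comm _ _) ≈-refl) (+-assoc _ _ _))))
  (≈-sym (+-assoc _ _ _))))
∂-cong j (con-+ a b)     = ≈-sym (+-idˡ _)
∂-cong j (con-* a b)     = ≈-sym
  (≈-trans (+-cong (*-zeroˡ _) (S.zeroʳ _)) (+-idˡ _))

nat : ℕ → Poly
nat m = con (+ m ℚ./ 1)

1/_! : ℕ → Poly
1/ m ! = con ((+ 1 ℚ./ (m !)) {{ m ℕ.!≢0 }})

-- ∑[ j ∈ a ⋯ b ] f j sums f over the integers a ≤ j ≤ b.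
∑-range : ℕ → ℕ → (ℕ → Poly) → Poly
∑-range a b f = sum {suc b ∸ a} (λ i → f (a ℕ.+ toℕ i))

infixl 5 ∑-range
syntax ∑-range a b (λ j → p) = ∑[ j ∈ a ⋯ b ] p

-- Position i of a vector, counted from 0 by Fin, holds the entry of index
-- j = suc (toℕ i) in the 1-based numbering of k_j and x_j.

weight : ∀ {m} → Vec ℕ m → ℕ
weight κ = Vec.sum (Vec.tabulate λ i → suc (toℕ i) ℕ.* lookup κ i)

box : ℕ → (m : ℕ) → List (Vec ℕ m)
box b zero    = Vec.[] ∷ []
box b (suc m) = cartesianProductWith Vec._∷_ (upTo (suc b)) (box b m)

-- Entries summing to k are each at most k, so searching the box {0,…,k}^(n-k+1)
-- omits no element of Λ; each element is listed exactly once.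
Λ : (n k : ℕ) → List (Vec ℕ (suc (n ∸ k)))
Λ n k = filter (λ κ → (Vec.sum κ ℕ.≟ k) ×-dec (weight κ ℕ.≟ n)) (box k (suc (n ∸ k)))

-- The partial exponential Bell polynomial evaluated at x_1, …, x_{n-k+1};
-- meaningful for 1 ≤ k ≤ n.
B : (n k : ℕ) → Vector Poly (suc (n ∸ k)) → Poly
B n k x = nat (n !) * foldr _+_ (con 0ℚ) (List.map term (Λ n k))
  where
  term : Vec ℕ (suc (n ∸ k)) → Poly
  term κ = product λ i →
    1/ lookup κ i ! * (x i * 1/ suc (toℕ i) !) ^ lookup κ i

-- The arguments 1! u_1, 2! u_2, …, m! u_m.
j!u : ∀ {m} → Vector Poly m
j!u i = nat (suc (toℕ i) !) * u (suc (toℕ i))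

{-# OPTIONS --safe #-}
module Submission where

-- Up to the factor n !, B n k is the sum E k n of the monomials
-- ∏ u_j^{k_j} / k_j ! with Σ k_j = k and Σ j k_j = n.  Lowering k_j by one
-- shows ∂ E k n / ∂ u_j = E (k − 1) (n − j), and since these monomials are
-- isobaric of weight n, Euler's identity n · E k n = Σ_j j u_j ∂ E k n / ∂ u_j
-- holds.  Multiplied by (n − 1)!, it is the first formula; after splitting off
-- j = 1 and reindexing, it is the second.

open import Defs
open import Algebra.Bundles using (CommutativeRing)
open import Data.Bool.Base using (true; false; if_then_else_)
open import Data.Fin.Base as Fin using (Fin; toℕ)
open import Data.Integer.Base as ℤ using (+_)
import Data.Integer.Properties as ℤ
open import Data.List.Base as List using (List; []; _∷_; _++_; filter; applyUpTo; cartesianProductWith)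
import Data.List.Properties as List
open import Data.Nat.Base as ℕ using (ℕ; zero; suc; _∸_; _≤_; _<_; _!; s≤s; z≤n)
open import Data.Nat.Combinatorics using (_P_; nPk≡n!/[n∸k]!)
open import Data.Nat.Divisibility using (m≤n⇒m!∣n!)
open import Data.Nat.DivMod using (m/n*n≡m)
import Data.Nat.Properties as ℕ
open import Data.Product.Base using (_×_; _,_)
open import Data.Rational.Base as ℚ using (0ℚ; 1ℚ)
import Data.Rational.Properties as ℚ
open import Data.Rational.Unnormalised.Base as ℚᵘ using (mkℚᵘ; *≡*)
import Data.Rational.Unnormalised.Properties as ℚᵘ
open import Data.Sum.Base using (inj₁; inj₂)
open import Data.Vec.Base as Vec using (Vec; []; _∷_; lookup)
open import Data.Vec.Functional using (Vector)
open import Function.Base using (_∘_)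
open import Relation.Binary.PropositionalEquality.Core as ≡ using (_≡_; _≢_)
open import Relation.Nullary.Decidable using (Dec; yes; no; does; _×-dec_; dec-false)
open import Relation.Nullary.Negation using (¬_; contradiction)
open import Relation.Unary using (Decidable)

open CommutativeRing polyRing
  using ( semiring; commutativeSemiring; setoid; reflexive; +-congˡ; +-congʳ; *-congˡ; *-congʳ
        ; zeroˡ; zeroʳ; distribˡ; +-identityʳ; *-identityʳ)
open import Algebra.Properties.CommutativeSemigroup ℕ.+-commutativeSemigroup using (x∙yz≈y∙xz)
open import Algebra.Properties.Semiring.Exp semiring using (^-congˡ)
open import Algebra.Solver.Ring.NaturalCoefficients.Default commutativeSemiring
  using (solve; _:=_; _:+_; _:*_)
open import Relation.Binary.Reasoning.Setoid setoid

-- Arithmetic of natural numbers and inverse factorials as constants.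

private
  fromℚᵘ-homo-* : ∀ p q → ℚ.fromℚᵘ (p ℚᵘ.* q) ≡ ℚ.fromℚᵘ p ℚ.* ℚ.fromℚᵘ q
  fromℚᵘ-homo-* p q = ℚ.toℚᵘ-injective (ℚᵘ.≃-trans (ℚ.toℚᵘ-fromℚᵘ (p ℚᵘ.* q))
    (ℚᵘ.≃-sym (ℚᵘ.≃-trans (ℚ.toℚᵘ-homo-* (ℚ.fromℚᵘ p) (ℚ.fromℚᵘ q))
      (ℚᵘ.*-cong (ℚ.toℚᵘ-fromℚᵘ p) (ℚ.toℚᵘ-fromℚᵘ q)))))

  fromℚᵘ-homo-+ : ∀ p q → ℚ.fromℚᵘ (p ℚᵘ.+ q) ≡ ℚ.fromℚᵘ p ℚ.+ ℚ.fromℚᵘ q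
  fromℚᵘ-homo-+ p q = ℚ.toℚᵘ-injective (ℚᵘ.≃-trans (ℚ.toℚᵘ-fromℚᵘ (p ℚᵘ.+ q))
    (ℚᵘ.≃-sym (ℚᵘ.≃-trans (ℚ.toℚᵘ-homo-+ (ℚ.fromℚᵘ p) (ℚ.fromℚᵘ q))
      (ℚᵘ.+-cong (ℚ.toℚᵘ-fromℚᵘ p) (ℚ.toℚᵘ-fromℚᵘ q)))))

nat-+ : ∀ a b → nat (a ℕ.+ b) ≈ nat a + nat b
nat-+ a b = ≈-trans (reflexive (≡.cong con (≡.trans
  (ℚ.fromℚᵘ-cong {mkℚᵘ (+ (a ℕ.+ b)) 0} {mkℚᵘ (+ a) 0 ℚᵘ.+ mkℚᵘ (+ b) 0}
    (*≡* (≡.cong (ℤ._* + 1) (≡.sym (≡.cong₂ ℤ._+_ (ℤ.*-identityʳ (+ a)) (ℤ.*-identityʳ (+ b)))))))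
  (fromℚᵘ-homo-+ (mkℚᵘ (+ a) 0) (mkℚᵘ (+ b) 0))))) (con-+ _ _)

nat-* : ∀ a b → nat (a ℕ.* b) ≈ nat a * nat b
nat-* a b = ≈-trans (reflexive (≡.cong con (≡.trans
  (ℚ.fromℚᵘ-cong {mkℚᵘ (+ (a ℕ.* b)) 0} {mkℚᵘ (+ a) 0 ℚᵘ.* mkℚᵘ (+ b) 0}
    (*≡* (≡.cong (ℤ._* + 1) (ℤ.pos-* a b))))
  (fromℚᵘ-homo-* (mkℚᵘ (+ a) 0) (mkℚᵘ (+ b) 0))))) (con-* _ _)

nat-!-inverse : ∀ m → nat (m !) * 1/ m ! ≈ con 1ℚ
nat-!-inverse m = go (m !) {{m ℕ.!≢0}}
  where
  -- `m !` does not reduce to a successor; abstracting it as `d` makes the fraction computable by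
  -- matching on `suc d`.
  go : ∀ d .{{_ : ℕ.NonZero d}} → nat d * con (+ 1 ℚ./ d) ≈ con 1ℚ
  go (suc d) = ≈-trans (≈-sym (con-* _ _)) (reflexive (≡.cong con (≡.trans
    (≡.sym (fromℚᵘ-homo-* (mkℚᵘ (+ suc d) 0) (mkℚᵘ (+ 1) d)))
    (ℚ.fromℚᵘ-cong {mkℚᵘ (+ suc d) 0 ℚᵘ.* mkℚᵘ (+ 1) d} {mkℚᵘ (+ 1) 0}
      (*≡* (≡.cong +_ (≡.trans (ℕ.*-identityʳ _) (≡.trans (ℕ.*-identityʳ _)
         (≡.sym (≡.trans (ℕ.*-identityˡ _) (ℕ.*-identityˡ _)))))))))))

1/!-suc : ∀ c → nat (suc c) * 1/ suc c ! ≈ 1/ c !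
1/!-suc c = begin
  nat (suc c) * 1/ suc c !
    ≈⟨ *-idˡ _ ⟨
  con 1ℚ * (nat (suc c) * 1/ suc c !)
    ≈⟨ *-congʳ (nat-!-inverse c) ⟨
  nat (c !) * 1/ c ! * (nat (suc c) * 1/ suc c !)
    ≈⟨ solve 4 (λ x y z w → x :* y :* (z :* w) := y :* (z :* x :* w)) ≈-refl
         (nat (c !)) (1/ c !) (nat (suc c)) (1/ suc c !) ⟩
  1/ c ! * (nat (suc c) * nat (c !) * 1/ suc c !)
    ≈⟨ *-congˡ (*-congʳ (nat-* (suc c) (c !))) ⟨
  1/ c ! * (nat (suc c !) * 1/ suc c !)
    ≈⟨ *-congˡ (nat-!-inverse (suc c)) ⟩
  1/ c ! * con 1ℚ
    ≈⟨ ≈-trans (*-comm _ _) (*-idˡ _) ⟩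
  1/ c ! ∎

-- Finite sums over initial segments.

-- Opaque, so that unification does not unfold sums over suc n.
opaque
  ∑< : ℕ → (ℕ → Poly) → Poly
  ∑< zero    f = con 0ℚ
  ∑< (suc n) f = f 0 + ∑< n (f ∘ suc)

infixl 5 ∑<
syntax ∑< n (λ i → p) = ∑[ i < n ] p

opaque
  unfolding ∑<

  sum≈∑ : ∀ n f → sum {n} (f ∘ toℕ) ≈ ∑< n f
  sum≈∑ zero    f = ≈-refl
  sum≈∑ (suc n) f = +-congˡ (sum≈∑ n (f ∘ suc))

  ∑-cong : ∀ n {f g} → (∀ i → i < n → f i ≈ g i) → ∑< n f ≈ ∑< n g
  ∑-cong zero    f≈g = ≈-refl
  ∑-cong (suc n) f≈g = +-cong (f≈g 0 ℕ.z<s) (∑-cong n (λ i i<n → f≈g (suc i) (s≤s i<n)))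

  ∑-+ : ∀ n f g → ∑[ i < n ] (f i + g i) ≈ ∑< n f + ∑< n g
  ∑-+ zero    f g = ≈-sym (+-idˡ _)
  ∑-+ (suc n) f g = ≈-trans (+-congˡ (∑-+ n (f ∘ suc) (g ∘ suc)))
    (solve 4 (λ x y z w → x :+ y :+ (z :+ w) := x :+ z :+ (y :+ w)) ≈-refl _ _ _ _)

  ∑-*ˡ : ∀ n p f → p * ∑< n f ≈ ∑[ i < n ] (p * f i)
  ∑-*ˡ zero    p f = zeroʳ p
  ∑-*ˡ (suc n) p f = ≈-trans (distribˡ p _ _) (+-congˡ (∑-*ˡ n p (f ∘ suc)))

  ∑-zero : ∀ n {f} → (∀ i → i < n → f i ≈ con 0ℚ) → ∑< n f ≈ con 0ℚ
  ∑-zero zero    f≈0 = ≈-refl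
  ∑-zero (suc n) f≈0 =
    ≈-trans (+-cong (f≈0 0 ℕ.z<s) (∑-zero n (λ i i<n → f≈0 (suc i) (s≤s i<n)))) (+-idˡ _)

  ∑-head : ∀ n f → ∑< (suc n) f ≈ f 0 + ∑< n (f ∘ suc)
  ∑-head n f = ≈-refl

  ∑-last : ∀ n f → ∑< (suc n) f ≈ ∑< n f + f n
  ∑-last zero    f = +-comm _ _
  ∑-last (suc n) f = ≈-trans (+-congˡ (∑-last n (f ∘ suc))) (≈-sym (+-assoc _ _ _))

  -- Reindexing for a lowered exponent: `f 0` drops out, every other term moves down one place, and
  -- the vacated place `b` takes `g b`, which is zero, so both sums run over the same range.
  ∑-shift : ∀ b {f g} → f 0 ≈ con 0ℚ → (∀ c → f (suc c) ≈ g c) → g b ≈ con 0ℚ →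
            ∑< (suc b) f ≈ ∑< (suc b) g
  ∑-shift b {f} {g} f₀≈0 f≈g gb≈0 = begin
    f 0 + ∑< b (f ∘ suc) ≈⟨ +-cong f₀≈0 (∑-cong b (λ c _ → f≈g c)) ⟩
    con 0ℚ + ∑< b g      ≈⟨ +-comm _ _ ⟩
    ∑< b g + con 0ℚ      ≈⟨ +-congˡ gb≈0 ⟨
    ∑< b g + g b         ≈⟨ ∑-last b g ⟨
    ∑< (suc b) g         ∎

  ∑-comm : ∀ m n (f : ℕ → ℕ → Poly) →
           ∑[ i < m ] ∑[ j < n ] f i j ≈ ∑[ j < n ] ∑[ i < m ] f i j
  ∑-comm zero    n f = ≈-sym (∑-zero n (λ _ _ → ≈-refl))
  ∑-comm (suc m) n f = ≈-trans (+-congˡ (∑-comm m n (f ∘ suc))) (≈-sym (∑-+ n _ _))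

  ∂-∑ : ∀ j n f → ∂ j (∑< n f) ≈ ∑< n (∂ j ∘ f)
  ∂-∑ j zero    f = ≈-refl
  ∂-∑ j (suc n) f = +-congˡ (∂-∑ j n (f ∘ suc))

-- Derivatives of variables and divided powers.

∂-u-same : ∀ j → ∂ j (u j) ≈ con 1ℚ
∂-u-same j with j ℕ.≟ j
... | yes _   = ≈-refl
... | no j≢j = contradiction ≡.refl j≢j

∂-u-other : ∀ {i j} → i ≢ j → ∂ j (u i) ≈ con 0ℚ
∂-u-other {i} {j} i≢j with i ℕ.≟ j
... | yes i≡j = contradiction i≡j i≢j
... | no _    = ≈-refl

∂-con-* : ∀ j a p → ∂ j (con a * p) ≈ con a * ∂ j p
∂-con-* j a p = ≈-trans (+-congʳ (*-zeroˡ p)) (+-idˡ _)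

-- The divided power u_j^c / c !.
γ : ℕ → ℕ → Poly
γ j c = 1/ c ! * u j ^ c

∂-u^ : ∀ j c → ∂ j (u j ^ suc c) ≈ nat (suc c) * u j ^ c
∂-u^ j zero = ≈-trans (+-cong (*-congʳ (∂-u-same j)) (zeroʳ _))
                (+-identityʳ _)
∂-u^ j (suc c) = begin
  ∂ j (u j) * u j ^ suc c + u j * ∂ j (u j ^ suc c)
    ≈⟨ +-cong (*-congʳ (∂-u-same j)) (*-congˡ (∂-u^ j c)) ⟩
  con 1ℚ * u j ^ suc c + u j * (nat (suc c) * u j ^ c)
    ≈⟨ +-congˡ (solve 3 (λ x y z → x :* (y :* z) := y :* (x :* z)) ≈-refl (u j) (nat (suc c)) (u j ^ c)) ⟩
  con 1ℚ * u j ^ suc c + nat (suc c) * u j ^ suc c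
    ≈⟨ distribʳ _ _ _ ⟨
  (nat 1 + nat (suc c)) * u j ^ suc c
    ≈⟨ *-congʳ (nat-+ 1 (suc c)) ⟨
  nat (suc (suc c)) * u j ^ suc c ∎

∂-γ-zero : ∀ j i → ∂ j (γ i 0) ≈ con 0ℚ
∂-γ-zero j i = ≈-trans (∂-con-* j _ _) (zeroʳ _)

-- The factor `suc c` from the power rule cancels against the factorial, so differentiating a
-- divided power creates no coefficient.
∂-γ-suc : ∀ j c → ∂ j (γ j (suc c)) ≈ γ j c
∂-γ-suc j c = begin
  ∂ j (γ j (suc c))                   ≈⟨ ∂-con-* j _ _ ⟩
  1/ suc c ! * ∂ j (u j ^ suc c)      ≈⟨ *-congˡ (∂-u^ j c) ⟩
  1/ suc c ! * (nat (suc c) * u j ^ c) ≈⟨ solve 3 (λ x y z → x :* (y :* z) := y :* x :* z) ≈-refl _ _ _ ⟩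
  nat (suc c) * 1/ suc c ! * u j ^ c  ≈⟨ *-congʳ (1/!-suc c) ⟩
  γ j c ∎

∂-γ-other : ∀ {i j} → i ≢ j → ∀ c → ∂ j (γ i c) ≈ con 0ℚ
∂-γ-other {i} {j} i≢j c = ≈-trans (∂-con-* j _ _) (≈-trans (*-congˡ (go c)) (zeroʳ _))
  where
  go : ∀ c → ∂ j (u i ^ c) ≈ con 0ℚ
  go zero    = ≈-refl
  go (suc c) = ≈-trans (+-cong (≈-trans (*-congʳ (∂-u-other i≢j)) (zeroˡ _))
                               (≈-trans (*-congˡ (go c)) (zeroʳ _))) (+-idˡ _)

-- The one-variable case of Euler's identity: a factor equal to the exponent releases one copy of
-- the variable.
γ-suc : ∀ j c → nat (suc c) * γ j (suc c) ≈ u j * γ j c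
γ-suc j c = begin
  nat (suc c) * (1/ suc c ! * (u j * u j ^ c))
    ≈⟨ solve 4 (λ x y z w → x :* (y :* (z :* w)) := z :* (x :* y :* w)) ≈-refl _ _ _ _ ⟩
  u j * (nat (suc c) * 1/ suc c ! * u j ^ c)
    ≈⟨ *-congˡ (*-congʳ (1/!-suc c)) ⟩
  u j * γ j c ∎

γ-zero : ∀ j → γ j 0 ≈ con 1ℚ
γ-zero j = *-idˡ _

-- Sums of monomials over a box of exponents, and their independence of its size.

shift : ℕ → ℕ → (ℕ → ℕ → ℕ) → ℕ → ℕ → ℕ
shift c d φ s w = φ (c ℕ.+ s) (d ℕ.+ w)

-- T b m o φ is the sum over κ ∈ {0,…,b}^m of ∏ u_{o+i}^{κ_i} / κ_i ! · φ s w,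
-- where s = Σ κ_i, w = Σ (o + i) κ_i and 1 ≤ i ≤ m (see ∑-box).
T : (b m o : ℕ) → (ℕ → ℕ → ℕ) → Poly
T b zero    o φ = nat (φ 0 0)
T b (suc m) o φ = ∑[ c < suc b ] (γ (suc o) c * T b m (suc o) (shift c (suc o ℕ.* c) φ))

T-cong : ∀ b m o {φ ψ} → (∀ s w → φ s w ≡ ψ s w) → T b m o φ ≈ T b m o ψ
T-cong b zero    o φ≡ψ = reflexive (≡.cong nat (φ≡ψ 0 0))
T-cong b (suc m) o φ≡ψ = ∑-cong (suc b) λ c _ → *-congˡ (T-cong b m (suc o) (λ s w → φ≡ψ _ _))

T-scale : ∀ b m o a φ → T b m o (λ s w → a ℕ.* φ s w) ≈ nat a * T b m o φ
T-scale b zero    o a φ = nat-* a (φ 0 0)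
T-scale b (suc m) o a φ = begin
  ∑[ c < suc b ] (γ (suc o) c * T b m (suc o) (λ s w → a ℕ.* shift c (suc o ℕ.* c) φ s w))
    ≈⟨ ∑-cong (suc b) (λ c _ → ≈-trans (*-congˡ (T-scale b m (suc o) a _))
         (solve 3 (λ x y z → x :* (y :* z) := y :* (x :* z)) ≈-refl _ _ _)) ⟩
  ∑[ c < suc b ] (nat a * (γ (suc o) c * T b m (suc o) (shift c (suc o ℕ.* c) φ)))
    ≈⟨ ∑-*ˡ (suc b) (nat a) _ ⟨
  nat a * T b (suc m) o φ ∎

T-zero : ∀ b m o {φ} → (∀ s w → φ s w ≡ 0) → T b m o φ ≈ con 0ℚ
T-zero b m o {φ} φ≡0 = begin
  T b m o φ                     ≈⟨ T-cong b m o φ≡0 ⟩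
  T b m o (λ s w → 0 ℕ.* φ s w) ≈⟨ T-scale b m o 0 φ ⟩
  nat 0 * T b m o φ             ≈⟨ *-zeroˡ _ ⟩
  con 0ℚ ∎

Bounded : ℕ → (ℕ → ℕ → ℕ) → Set
Bounded b φ = ∀ s w → b < s → φ s w ≡ 0

shift-bounded : ∀ {b φ} c d → Bounded b φ → Bounded b (shift c d φ)
shift-bounded c d φ-bounded s w b<s = φ-bounded _ _ (ℕ.≤-trans b<s (ℕ.m≤n+m s c))

-- Each added exponent vector has an entry `suc b`, so its count exceeds `b` and `φ` is zero there.
T-box : ∀ b m o {φ} → Bounded b φ → T (suc b) m o φ ≈ T b m o φ
T-box b zero    o φ-bounded = ≈-refl
T-box b (suc m) o {φ} φ-bounded = begin
  T (suc b) (suc m) o φ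
    ≈⟨ ∑-last (suc b) _ ⟩
  (∑[ c < suc b ] (γ (suc o) c * T (suc b) m (suc o) (shift c (suc o ℕ.* c) φ)))
    + γ (suc o) (suc b) * T (suc b) m (suc o) (shift (suc b) (suc o ℕ.* suc b) φ)
    ≈⟨ +-cong (∑-cong (suc b) λ c _ → *-congˡ (T-box b m (suc o) (shift-bounded c (suc o ℕ.* c) φ-bounded)))
         (≈-trans (*-congˡ (T-zero (suc b) m (suc o) λ s w → φ-bounded _ _ (ℕ.m≤m+n (suc b) s))) (zeroʳ _)) ⟩
  T b (suc m) o φ + con 0ℚ
    ≈⟨ +-identityʳ _ ⟩
  T b (suc m) o φ ∎

-- Makes φ vanish at κ as soon as κ involves a variable of index above N:
-- the other s variables contribute at least s to the weight.
Truncated : ℕ → (ℕ → ℕ → ℕ) → Set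
Truncated N φ = ∀ s w → s ℕ.+ suc N ≤ w → φ (suc s) w ≡ 0

-- The `c` copies of `u (suc o)` add `c` to the count and at least `c` to the weight, so the
-- inequality survives them.
shift-truncated : ∀ {N} φ o c → Truncated N φ → Truncated N (shift c (suc o ℕ.* c) φ)
shift-truncated {N} φ o c φ-truncated s w s+N<w =
  ≡.trans (≡.cong (λ t → φ t (suc o ℕ.* c ℕ.+ w)) (ℕ.+-suc c s))
    (φ-truncated (c ℕ.+ s) _ (ℕ.≤-trans (ℕ.≤-reflexive (ℕ.+-assoc c s (suc N)))
      (ℕ.+-mono-≤ (ℕ.m≤n*m c (suc o)) s+N<w)))

-- The last variable has index `suc (o ℕ.+ m)`. Truncation kills every term in which it occurs, and
-- the terms where its exponent is zero remain.
T-truncate : ∀ b m o {φ} → Truncated (o ℕ.+ m) φ → T b (suc m) o φ ≈ T b m o φ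
T-truncate b zero o {φ} φ-truncated = begin
  T b 1 o φ
    ≈⟨ ∑-head b _ ⟩
  γ (suc o) 0 * nat (φ 0 (suc o ℕ.* 0 ℕ.+ 0))
    + (∑[ c < b ] (γ (suc o) (suc c) * nat (φ (suc c ℕ.+ 0) (suc o ℕ.* suc c ℕ.+ 0))))
    ≈⟨ +-cong (≈-trans (*-congʳ (γ-zero (suc o))) (*-idˡ _))
        (∑-zero b λ c _ → ≈-trans (*-congˡ (reflexive (≡.cong nat (φ-truncated _ _
          (bound c))))) (zeroʳ _)) ⟩
  nat (φ 0 (suc o ℕ.* 0 ℕ.+ 0)) + con 0ℚ
    ≈⟨ +-identityʳ _ ⟩
  nat (φ 0 (suc o ℕ.* 0 ℕ.+ 0))
    ≡⟨ ≡.cong (nat ∘ φ 0) (≡.trans (ℕ.+-identityʳ _) (ℕ.*-zeroʳ (suc o))) ⟩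
  nat (φ 0 0) ∎
  where
  -- One copy of `u (suc o)` weighs `suc o`; each of the other `c` copies weighs at least one.
  bound : ∀ c → c ℕ.+ 0 ℕ.+ suc (o ℕ.+ 0) ≤ suc o ℕ.* suc c ℕ.+ 0
  bound c rewrite ℕ.+-identityʳ c | ℕ.+-identityʳ o | ℕ.+-identityʳ (c ℕ.+ o ℕ.* suc c) | ℕ.+-suc c o =
    s≤s (ℕ.+-monoʳ-≤ c (ℕ.m≤m*n o (suc c)))
T-truncate b (suc m) o {φ} φ-truncated = ∑-cong (suc b) λ c _ → *-congˡ
  (T-truncate b m (suc o) (shift-truncated φ o c (≡.subst (λ N → Truncated N φ) (ℕ.+-suc o m) φ-truncated)))

-- Differentiation of the box sums.

∂-T-fresh : ∀ {j} b m o φ → j ≤ o → ∂ j (T b m o φ) ≈ con 0ℚ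
∂-T-fresh b zero    o φ j≤o = ≈-refl
∂-T-fresh {j} b (suc m) o φ j≤o = ≈-trans (∂-∑ j (suc b) _) (∑-zero (suc b) λ c _ →
  ≈-trans (+-cong
    (≈-trans (*-congʳ (∂-γ-other (ℕ.>⇒≢ (s≤s j≤o)) c)) (zeroˡ _))
    (≈-trans (*-congˡ (∂-T-fresh b m (suc o) _ (ℕ.m≤n⇒m≤1+n j≤o))) (zeroʳ _)))
  (+-idˡ _))

-- One of the `suc c` copies of `u (suc o)` is handed over to `φ`, leaving exponent `c`.
T-shift-suc : ∀ b m o c φ →
  T b m (suc o) (shift (suc c) (suc o ℕ.* suc c) φ) ≈
  T b m (suc o) (shift c (suc o ℕ.* c) (shift 1 (suc o) φ))
T-shift-suc b m o c φ = T-cong b m (suc o) λ s w →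
  ≡.cong (φ (suc (c ℕ.+ s))) (≡.trans (≡.cong (ℕ._+ w) (ℕ.*-suc (suc o) c)) (ℕ.+-assoc (suc o) _ w))

-- For the term that `∑-shift` adds at the end: exponent `b` plus the copy handed over to `φ` gives
-- a count above `b`.
T-shift-last : ∀ b m o φ → Bounded b φ →
  T b m (suc o) (shift b (suc o ℕ.* b) (shift 1 (suc o) φ)) ≈ con 0ℚ
T-shift-last b m o φ φ-bounded = T-zero b m (suc o) λ s w → φ-bounded _ _ (s≤s (ℕ.m≤m+n b s))

-- The derivative lowers one exponent, but `φ` must still see the old count and weight, which exceed
-- the new ones by one and `suc i`. Boundedness lets the box keep its side.
∂-T : ∀ b m o i {φ} → Bounded b φ → o ≤ i → i < o ℕ.+ m →
      ∂ (suc i) (T b m o φ) ≈ T b m o (shift 1 (suc i) φ)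
∂-T b zero o i φ-bounded o≤i i<o = contradiction o≤i (ℕ.<⇒≱ (≡.subst (i <_) (ℕ.+-identityʳ o) i<o))
∂-T b (suc m) o i {φ} φ-bounded o≤i i<o+m with ℕ.m≤n⇒m<n∨m≡n o≤i
-- The differentiated variable comes later: the factor in `u (suc o)` is constant, and the two
-- shifts commute.
... | inj₁ o<i = ≈-trans (∂-∑ (suc i) (suc b) _) (∑-cong (suc b) λ c _ → begin
  ∂ (suc i) (γ (suc o) c) * T b m (suc o) (shift c (suc o ℕ.* c) φ)
    + γ (suc o) c * ∂ (suc i) (T b m (suc o) (shift c (suc o ℕ.* c) φ))
    ≈⟨ +-cong (≈-trans (*-congʳ (∂-γ-other (ℕ.<⇒≢ (s≤s o<i)) c)) (zeroˡ _))
         (*-congˡ (≈-trans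
           (∂-T b m (suc o) i (shift-bounded c (suc o ℕ.* c) φ-bounded) o<i
             (≡.subst (i <_) (ℕ.+-suc o m) i<o+m))
           (T-cong b m (suc o) λ s w → ≡.cong₂ φ (ℕ.+-suc c s) (x∙yz≈y∙xz (suc o ℕ.* c) (suc i) w)))) ⟩
  con 0ℚ + γ (suc o) c * T b m (suc o) (shift c (suc o ℕ.* c) (shift 1 (suc i) φ))
    ≈⟨ +-idˡ _ ⟩
  γ (suc o) c * T b m (suc o) (shift c (suc o ℕ.* c) (shift 1 (suc i) φ)) ∎)
-- The differentiated variable is the first one, which is absent from the inner sum.
... | inj₂ ≡.refl = begin
  ∂ (suc o) (T b (suc m) o φ)
    ≈⟨ ∂-∑ (suc o) (suc b) _ ⟩
  ∑[ c < suc b ] (∂ (suc o) (γ (suc o) c) * T b m (suc o) (shift c (suc o ℕ.* c) φ)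
    + γ (suc o) c * ∂ (suc o) (T b m (suc o) (shift c (suc o ℕ.* c) φ)))
    ≈⟨ ∑-cong (suc b) (λ c _ → ≈-trans (+-congˡ (≈-trans
         (*-congˡ (∂-T-fresh b m (suc o) _ ℕ.≤-refl)) (zeroʳ _))) (+-identityʳ _)) ⟩
  ∑[ c < suc b ] (∂ (suc o) (γ (suc o) c) * T b m (suc o) (shift c (suc o ℕ.* c) φ))
    ≈⟨ ∑-shift b (≈-trans (*-congʳ (∂-γ-zero (suc o) (suc o))) (zeroˡ _))
         (λ c → *-cong (∂-γ-suc (suc o) c) (T-shift-suc b m o c φ))
         (≈-trans (*-congˡ (T-shift-last b m o φ φ-bounded)) (zeroʳ _)) ⟩
  T b (suc m) o (shift 1 (suc o) φ) ∎

-- Euler's identity for the box sums.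

-- The summand a absorbs the contribution of the first variable in the induction on m.
T-euler : ∀ b m o a {φ} → Bounded b φ →
  T b m o (λ s w → (a ℕ.+ w) ℕ.* φ s w) ≈
  nat a * T b m o φ + (∑[ i < m ] (nat (suc o ℕ.+ i) * u (suc o ℕ.+ i) * T b m o (shift 1 (suc o ℕ.+ i) φ)))
T-euler b zero o a {φ} φ-bounded = ≈-trans
  (reflexive (≡.cong (λ n → nat (n ℕ.* φ 0 0)) (ℕ.+-identityʳ a)))
  (≈-trans (nat-* a (φ 0 0)) (≈-sym (≈-trans (+-congˡ (∑-zero 0 λ _ ())) (+-identityʳ _))))
T-euler b (suc m) o a {φ} φ-bounded = begin
  ∑[ c < suc b ] (γ (suc o) c * T b m (suc o) (λ s w → (a ℕ.+ (suc o ℕ.* c ℕ.+ w)) ℕ.* F c s w))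
    ≈⟨ ∑-cong (suc b) (λ c _ → *-congˡ (≈-trans
        (T-cong b m (suc o) (λ s w → ≡.cong (ℕ._* F c s w) (≡.sym (ℕ.+-assoc a (suc o ℕ.* c) w))))
        (≈-trans (T-euler b m (suc o) (a ℕ.+ suc o ℕ.* c) (shift-bounded c (suc o ℕ.* c) φ-bounded))
          (+-congʳ (*-congʳ (≈-trans (nat-+ a (suc o ℕ.* c)) (+-congˡ (nat-* (suc o) c)))))))) ⟩
  ∑[ c < suc b ] (γ (suc o) c * ((nat a + nat (suc o) * nat c) * G c + R c))
    ≈⟨ ∑-cong (suc b) (λ c _ → solve 6 (λ g a o c G R → g :* ((a :+ o :* c) :* G :+ R)
         := a :* (g :* G) :+ (o :* (c :* g :* G) :+ g :* R)) ≈-refl _ _ _ _ _ _) ⟩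
  ∑[ c < suc b ] (nat a * (γ (suc o) c * G c) + (nat (suc o) * (nat c * γ (suc o) c * G c) + γ (suc o) c * R c))
    ≈⟨ ≈-trans (∑-+ (suc b) _ _) (+-cong (≈-sym (∑-*ˡ (suc b) _ _))
         (≈-trans (∑-+ (suc b) _ _) (+-congʳ (≈-sym (∑-*ˡ (suc b) _ _))))) ⟩
  nat a * T b (suc m) o φ + (nat (suc o) * (∑[ c < suc b ] (nat c * γ (suc o) c * G c))
    + (∑[ c < suc b ] (γ (suc o) c * R c)))
    -- The terms with the factor `nat c` give the summand of the first variable, the terms with
    -- `R c` those of all later ones.
    ≈⟨ +-congˡ (≈-trans (+-cong first rest) (≈-sym (∑-head m _))) ⟩
  nat a * T b (suc m) o φ
    + (∑[ i < suc m ] (nat (suc o ℕ.+ i) * u (suc o ℕ.+ i) * T b (suc m) o (shift 1 (suc o ℕ.+ i) φ))) ∎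
  where
  F : ℕ → ℕ → ℕ → ℕ
  F c = shift c (suc o ℕ.* c) φ

  G R : ℕ → Poly
  G c = T b m (suc o) (F c)
  R c = ∑[ i < m ] (nat (suc (suc o) ℕ.+ i) * u (suc (suc o) ℕ.+ i)
          * T b m (suc o) (shift 1 (suc (suc o) ℕ.+ i) (F c)))

  first : nat (suc o) * (∑[ c < suc b ] (nat c * γ (suc o) c * G c)) ≈
          nat (suc o ℕ.+ 0) * u (suc o ℕ.+ 0) * T b (suc m) o (shift 1 (suc o ℕ.+ 0) φ)
  first = begin
    nat (suc o) * (∑[ c < suc b ] (nat c * γ (suc o) c * G c))
      ≈⟨ *-congˡ (∑-shift b (≈-trans (*-congʳ (*-zeroˡ _)) (zeroˡ _))
           (λ c → ≈-trans (*-cong (γ-suc (suc o) c) (T-shift-suc b m o c φ)) (*-assoc _ _ _))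
           (≈-trans (*-congˡ (≈-trans (*-congˡ (T-shift-last b m o φ φ-bounded)) (zeroʳ _))) (zeroʳ _))) ⟩
    nat (suc o) * (∑[ c < suc b ] (u (suc o) * (γ (suc o) c * T b m (suc o) (shift c (suc o ℕ.* c) (shift 1 (suc o) φ)))))
      ≈⟨ *-congˡ (∑-*ˡ (suc b) (u (suc o)) _) ⟨
    nat (suc o) * (u (suc o) * T b (suc m) o (shift 1 (suc o) φ))
      ≈⟨ *-assoc _ _ _ ⟨
    nat (suc o) * u (suc o) * T b (suc m) o (shift 1 (suc o) φ)
      ≡⟨ ≡.cong (λ j → nat j * u j * T b (suc m) o (shift 1 j φ)) (≡.sym (ℕ.+-identityʳ (suc o))) ⟩
    nat (suc o ℕ.+ 0) * u (suc o ℕ.+ 0) * T b (suc m) o (shift 1 (suc o ℕ.+ 0) φ) ∎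

  rest : (∑[ c < suc b ] (γ (suc o) c * R c)) ≈
         ∑[ i < m ] (nat (suc o ℕ.+ suc i) * u (suc o ℕ.+ suc i) * T b (suc m) o (shift 1 (suc o ℕ.+ suc i) φ))
  rest = begin
    ∑[ c < suc b ] (γ (suc o) c * R c)
      ≈⟨ ∑-cong (suc b) (λ c _ → ∑-*ˡ m _ _) ⟩
    ∑[ c < suc b ] ∑[ i < m ] (γ (suc o) c * (nat (suc (suc o) ℕ.+ i) * u (suc (suc o) ℕ.+ i)
          * T b m (suc o) (shift 1 (suc (suc o) ℕ.+ i) (F c))))
      -- Exchanging the sums collects, for each later variable, all exponents of the first one into
      -- a single `T`.
      ≈⟨ ∑-comm (suc b) m _ ⟩
    ∑[ i < m ] ∑[ c < suc b ] (γ (suc o) c * (nat (suc (suc o) ℕ.+ i) * u (suc (suc o) ℕ.+ i)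
          * T b m (suc o) (shift 1 (suc (suc o) ℕ.+ i) (F c))))
      ≈⟨ ∑-cong m (λ i _ → begin
           _ ≈⟨ ∑-cong (suc b) (λ c _ → ≈-trans
                  (solve 3 (λ x y z → x :* (y :* z) := y :* (x :* z)) ≈-refl _ _ _)
                  (*-congˡ (*-congˡ (T-cong b m (suc o) λ s w →
                    ≡.cong₂ φ (ℕ.+-suc c s) (x∙yz≈y∙xz (suc o ℕ.* c) (suc (suc o) ℕ.+ i) w))))) ⟩
           _ ≈⟨ ∑-*ˡ (suc b) (nat (suc (suc o) ℕ.+ i) * u (suc (suc o) ℕ.+ i))
                  (λ c → γ (suc o) c * T b m (suc o) (shift c (suc o ℕ.* c) (shift 1 (suc (suc o) ℕ.+ i) φ))) ⟨
           _ ≡⟨ ≡.cong (λ j → nat j * u j * T b (suc m) o (shift 1 j φ)) (≡.sym (ℕ.+-suc (suc o) i)) ⟩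
           _ ∎) ⟩
    ∑[ i < m ] (nat (suc o ℕ.+ suc i) * u (suc o ℕ.+ suc i) * T b (suc m) o (shift 1 (suc o ℕ.+ suc i) φ)) ∎

-- Sums over lists, and the sum over `Λ` as a box sum.

private
  variable
    A A′ A″ : Set

∑ˡ : (A → Poly) → List A → Poly
∑ˡ f xs = List.foldr _+_ (con 0ℚ) (List.map f xs)

∑ˡ-cong : ∀ {f g : A → Poly} → (∀ x → f x ≈ g x) → ∀ xs → ∑ˡ f xs ≈ ∑ˡ g xs
∑ˡ-cong f≈g []       = ≈-refl
∑ˡ-cong f≈g (x ∷ xs) = +-cong (f≈g x) (∑ˡ-cong f≈g xs)

∑ˡ-*ˡ : ∀ p (f : A → Poly) xs → p * ∑ˡ f xs ≈ ∑ˡ (λ x → p * f x) xs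
∑ˡ-*ˡ p f []       = zeroʳ p
∑ˡ-*ˡ p f (x ∷ xs) = ≈-trans (distribˡ p _ _) (+-congˡ (∑ˡ-*ˡ p f xs))

∑ˡ-++ : ∀ (f : A → Poly) xs ys → ∑ˡ f (xs ++ ys) ≈ ∑ˡ f xs + ∑ˡ f ys
∑ˡ-++ f []       ys = ≈-sym (+-idˡ _)
∑ˡ-++ f (x ∷ xs) ys = ≈-trans (+-congˡ (∑ˡ-++ f xs ys)) (≈-sym (+-assoc _ _ _))

∑ˡ-cartesianProductWith : ∀ (f : A″ → Poly) (_∙_ : A → A′ → A″) xs ys →
  ∑ˡ f (cartesianProductWith _∙_ xs ys) ≈ ∑ˡ (λ x → ∑ˡ (λ y → f (x ∙ y)) ys) xs
∑ˡ-cartesianProductWith f _∙_ []       ys = ≈-refl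
∑ˡ-cartesianProductWith f _∙_ (x ∷ xs) ys = ≈-trans (∑ˡ-++ f (List.map (x ∙_) ys) _)
  (+-cong (reflexive (≡.cong (List.foldr _+_ (con 0ℚ)) (≡.sym (List.map-∘ ys))))
    (∑ˡ-cartesianProductWith f _∙_ xs ys))

∑ˡ-applyUpTo : ∀ (f : A → Poly) g n → ∑ˡ f (applyUpTo g n) ≈ ∑< n (f ∘ g)
∑ˡ-applyUpTo f g zero    = ≈-sym (∑-zero 0 λ _ ())
∑ˡ-applyUpTo f g (suc n) = ≈-trans (+-congˡ (∑ˡ-applyUpTo f (g ∘ suc) n)) (≈-sym (∑-head n _))

indicator : ∀ {P : Set} → Dec P → ℕ
indicator P? = if does P? then 1 else 0

-- Membership in `Λ` becomes a numerical factor, which can then serve as the argument `φ` of `T`.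
∑ˡ-filter : ∀ {P : A → Set} (P? : Decidable P) f xs →
  ∑ˡ f (filter P? xs) ≈ ∑ˡ (λ x → f x * nat (indicator (P? x))) xs
∑ˡ-filter P? f []       = ≈-refl
∑ˡ-filter P? f (x ∷ xs) with does (P? x)
... | true  = +-cong (≈-sym (*-identityʳ _)) (∑ˡ-filter P? f xs)
... | false = ≈-trans (∑ˡ-filter P? f xs) (≈-sym (≈-trans (+-congʳ (zeroʳ _)) (+-idˡ _)))

monomial : ∀ {m} → ℕ → Vec ℕ m → Poly
monomial o []      = con 1ℚ
monomial o (c ∷ κ) = γ (suc o) c * monomial (suc o) κ

weightFrom : ∀ {m} → ℕ → Vec ℕ m → ℕ
weightFrom o []      = 0
weightFrom o (c ∷ κ) = suc o ℕ.* c ℕ.+ weightFrom (suc o) κ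

-- The vector `x` and the offset `o` are general because the induction passes to tails, whose
-- indices start higher.
product≈monomial : ∀ {m} o (κ : Vec ℕ m) (x : Vector Poly m) → (∀ i → x i ≈ u (suc o ℕ.+ toℕ i)) →
  product (λ i → 1/ lookup κ i ! * x i ^ lookup κ i) ≈ monomial o κ
product≈monomial o []      x x≈u = ≈-refl
product≈monomial o (c ∷ κ) x x≈u = *-cong
  (*-congˡ (^-congˡ c (≈-trans (x≈u Fin.zero) (reflexive (≡.cong u (ℕ.+-identityʳ (suc o)))))))
  (product≈monomial (suc o) κ (x ∘ Fin.suc)
    (λ i → ≈-trans (x≈u (Fin.suc i)) (reflexive (≡.cong u (ℕ.+-suc (suc o) (toℕ i))))))

weight≡weightFrom : ∀ {m} o (κ : Vec ℕ m) (f : Fin m → ℕ) → (∀ i → f i ≡ suc o ℕ.+ toℕ i) →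
  Vec.sum (Vec.tabulate (λ i → f i ℕ.* lookup κ i)) ≡ weightFrom o κ
weight≡weightFrom o []      f f≡ = ≡.refl
weight≡weightFrom o (c ∷ κ) f f≡ = ≡.cong₂ ℕ._+_
  (≡.cong (ℕ._* c) (≡.trans (f≡ Fin.zero) (ℕ.+-identityʳ (suc o))))
  (weight≡weightFrom (suc o) κ (f ∘ Fin.suc) (λ i → ≡.trans (f≡ (Fin.suc i)) (ℕ.+-suc (suc o) (toℕ i))))

-- The first entry `c` contributes `c` to the count and `suc o ℕ.* c` to the weight, exactly what
-- `shift` records.
∑-box : ∀ b m o φ →
  ∑ˡ (λ κ → monomial o κ * nat (φ (Vec.sum κ) (weightFrom o κ))) (box b m) ≈ T b m o φ
∑-box b zero    o φ = ≈-trans (+-identityʳ _) (*-idˡ _)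
∑-box b (suc m) o φ = ≈-trans (∑ˡ-cartesianProductWith _ _∷_ (List.upTo (suc b)) (box b m))
  (≈-trans (∑ˡ-applyUpTo _ _ (suc b)) (∑-cong (suc b) λ c _ → begin
    ∑ˡ (λ κ → γ (suc o) c * monomial (suc o) κ * nat (shift c (suc o ℕ.* c) φ (Vec.sum κ) (weightFrom (suc o) κ))) (box b m)
      ≈⟨ ∑ˡ-cong (λ κ → *-assoc _ _ _) (box b m) ⟩
    ∑ˡ (λ κ → γ (suc o) c * (monomial (suc o) κ * nat (shift c (suc o ℕ.* c) φ (Vec.sum κ) (weightFrom (suc o) κ)))) (box b m)
      ≈⟨ ∑ˡ-*ˡ (γ (suc o) c) _ (box b m) ⟨
    γ (suc o) c * ∑ˡ (λ κ → monomial (suc o) κ * nat (shift c (suc o ℕ.* c) φ (Vec.sum κ) (weightFrom (suc o) κ))) (box b m)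
      ≈⟨ *-congˡ (∑-box b m (suc o) (shift c (suc o ℕ.* c) φ)) ⟩
    γ (suc o) c * T b m (suc o) (shift c (suc o ℕ.* c) φ) ∎))

-- The indicator of count `k` and weight `n`, and Bell polynomials without their factorial.

δ : ℕ → ℕ → ℕ → ℕ → ℕ
δ k n s w = indicator ((s ℕ.≟ k) ×-dec (w ℕ.≟ n))

δ-zero : ∀ k n s w → ¬ (s ≡ k × w ≡ n) → δ k n s w ≡ 0
δ-zero k n s w ¬p =
  ≡.cong (λ t → if t then 1 else 0) (dec-false ((s ℕ.≟ k) ×-dec (w ℕ.≟ n)) ¬p)

-- Isobaric property: wherever the indicator is nonzero, the weight is `n`.
δ-weight : ∀ k n s w → w ℕ.* δ k n s w ≡ n ℕ.* δ k n s w
δ-weight k n s w with w ℕ.≟ n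
... | yes ≡.refl = ≡.refl
... | no w≢n     = ≡.trans (zero-* w) (≡.sym (zero-* n))
  where
  zero-* : ∀ a → a ℕ.* δ k n s w ≡ 0
  zero-* a = ≡.trans (≡.cong (a ℕ.*_) (δ-zero k n s w λ (_ , w≡n) → w≢n w≡n)) (ℕ.*-zeroʳ a)

-- Decidable equality on successors computes to that on predecessors, so each unit of the shift
-- cancels by reduction.
δ-shift : ∀ k n j s w → shift 1 j (δ (suc k) (j ℕ.+ n)) s w ≡ δ k n s w
δ-shift k n zero    s w = ≡.refl
δ-shift k n (suc j) s w = δ-shift k n j s w

δ-bounded : ∀ {b} k n → k ≤ b → Bounded b (δ k n)
δ-bounded k n k≤b s w b<s = δ-zero k n s w λ (s≡k , _) → ℕ.<⇒≢ (ℕ.≤-<-trans k≤b b<s) (≡.sym s≡k)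

-- Among `k` variables, one of index above `N` and `k - 1` of index at least one together weigh at
-- least `k + N`, which exceeds `n`.
δ-truncated : ∀ {N} k n → n < k ℕ.+ N → Truncated N (δ k n)
δ-truncated {N} k n n<k+N s w s+N<w = δ-zero k n (suc s) w λ { (≡.refl , ≡.refl) →
  ℕ.<⇒≱ n<k+N (ℕ.≤-trans (ℕ.≤-reflexive (≡.sym (ℕ.+-suc s N))) s+N<w) }

E : ℕ → ℕ → Poly
E k n = T k (suc (n ∸ k)) 0 (δ k n)

-- The factor `j !` in the argument cancels the inverse factorial in `B`, leaving divided powers of
-- the `u j`.
bell : ∀ n k → B n k j!u ≈ nat (n !) * E k n
bell n k = *-congˡ (≈-trans (∑ˡ-filter _ _ (box k (suc (n ∸ k))))
  (≈-trans (∑ˡ-cong (λ κ → *-cong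
      (product≈monomial 0 κ (λ i → j!u i * 1/ suc (toℕ i) !) (λ i → x≈u (suc (toℕ i))))
      (reflexive (≡.cong (nat ∘ δ k n (Vec.sum κ)) (weight≡weightFrom 0 κ (suc ∘ toℕ) (λ _ → ≡.refl)))))
    (box k (suc (n ∸ k))))
  (∑-box k (suc (n ∸ k)) 0 (δ k n))))
  where
  x≈u : ∀ j → nat (j !) * u j * 1/ j ! ≈ u j
  x≈u j = begin
    nat (j !) * u j * 1/ j !   ≈⟨ solve 3 (λ x y z → x :* y :* z := x :* z :* y) ≈-refl _ _ _ ⟩
    nat (j !) * 1/ j ! * u j   ≈⟨ *-congʳ (nat-!-inverse j) ⟩
    con 1ℚ * u j               ≈⟨ *-idˡ _ ⟩
    u j                        ∎

-- Comparison of box sums of different sizes.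

T-box-≤ : ∀ {b b′} m o {φ} → Bounded b φ → b ≤ b′ → T b′ m o φ ≈ T b m o φ
T-box-≤ {b} m o {φ} φ-bounded b≤b′ = go (ℕ.≤⇒≤′ b≤b′)
  where
  go : ∀ {b′} → b ℕ.≤′ b′ → T b′ m o φ ≈ T b m o φ
  go (ℕ.≤′-reflexive ≡.refl) = ≈-refl
  go (ℕ.≤′-step b≤′b′) = ≈-trans
    (T-box _ m o λ s w b′<s → φ-bounded s w (ℕ.≤-<-trans (ℕ.≤′⇒≤ b≤′b′) b′<s)) (go b≤′b′)

T-truncate-≤ : ∀ b {m m′} o {φ} → Truncated (o ℕ.+ m) φ → m ≤ m′ → T b m′ o φ ≈ T b m o φ
T-truncate-≤ b {m} o {φ} φ-truncated m≤m′ = go (ℕ.≤⇒≤′ m≤m′)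
  where
  go : ∀ {m′} → m ℕ.≤′ m′ → T b m′ o φ ≈ T b m o φ
  go (ℕ.≤′-reflexive ≡.refl) = ≈-refl
  go (ℕ.≤′-step m≤′m′) = ≈-trans
    (T-truncate b _ o λ s w → φ-truncated s w ∘
      ℕ.≤-trans (ℕ.+-monoʳ-≤ s (s≤s (ℕ.+-monoʳ-≤ o (ℕ.≤′⇒≤ m≤′m′)))))
    (go m≤′m′)

-- Needed because lowering an exponent changes `k` and `n` in the indicator but not the surrounding
-- box.
T-δ : ∀ {b m k n} → k ≤ b → suc (n ∸ k) ≤ m → T b m 0 (δ k n) ≈ E k n
T-δ {b} {m} {k} {n} k≤b n∸k<m = ≈-trans
  (T-box-≤ m 0 (δ-bounded k n ℕ.≤-refl) k≤b)
  (T-truncate-≤ k 0 (δ-truncated k n n<k+1+n∸k) n∸k<m)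
  where
  n<k+1+n∸k : n < k ℕ.+ suc (n ∸ k)
  n<k+1+n∸k = ℕ.≤-trans (s≤s (ℕ.m≤n+m∸n n k)) (ℕ.≤-reflexive (≡.sym (ℕ.+-suc k (n ∸ k))))

-- Removing one copy of `u (suc i)` leaves count `k` and weight `n ∸ suc i`; the box of
-- `E (suc k) n` contains the one required, and `T-δ` discards the surplus.
T-shift-δ : ∀ {k n i} → suc k ≤ n → i < suc (n ∸ suc k) →
  T (suc k) (suc (n ∸ suc k)) 0 (shift 1 (suc i) (δ (suc k) n)) ≈ E k (n ∸ suc i)
T-shift-δ {k} {n} {i} k<n i≤n∸k = ≈-trans
  (T-cong (suc k) (suc (n ∸ suc k)) 0 λ s w → ≡.trans
    (≡.cong (λ t → shift 1 (suc i) (δ (suc k) t) s w) (≡.sym (ℕ.m+[n∸m]≡n i<n)))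
    (δ-shift k (n ∸ suc i) (suc i) s w))
  (T-δ (ℕ.n≤1+n k) (s≤s (ℕ.≤-trans
    (ℕ.≤-reflexive (ℕ.∸-+-assoc n (suc i) k))
    (ℕ.∸-monoʳ-≤ n (s≤s (ℕ.m≤n+m k i))))))
  where
  i<n : i < n
  i<n = ℕ.≤-trans i≤n∸k (ℕ.≤-trans (ℕ.≤-reflexive (≡.sym (ℕ.+-∸-assoc 1 k<n))) (ℕ.m∸n≤m n k))

-- Euler's identity and derivatives for Bell polynomials.

E-euler : ∀ {k n} → suc k ≤ n →
  nat n * E (suc k) n ≈ ∑[ i < suc (n ∸ suc k) ] (nat (suc i) * u (suc i) * E k (n ∸ suc i))
E-euler {k} {n} k<n = begin
  nat n * E (suc k) n
    ≈⟨ T-scale (suc k) m 0 n (δ (suc k) n) ⟨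
  T (suc k) m 0 (λ s w → n ℕ.* δ (suc k) n s w)
    ≈⟨ T-cong (suc k) m 0 (λ s w → ≡.sym (δ-weight (suc k) n s w)) ⟩
  T (suc k) m 0 (λ s w → w ℕ.* δ (suc k) n s w)
    -- No variable precedes the first, so `a` starts at 0.
    ≈⟨ T-euler (suc k) m 0 0 (δ-bounded (suc k) n ℕ.≤-refl) ⟩
  nat 0 * E (suc k) n + (∑[ i < m ] (nat (suc i) * u (suc i) * T (suc k) m 0 (shift 1 (suc i) (δ (suc k) n))))
    ≈⟨ ≈-trans (+-congʳ (*-zeroˡ _)) (+-idˡ _) ⟩
  ∑[ i < m ] (nat (suc i) * u (suc i) * T (suc k) m 0 (shift 1 (suc i) (δ (suc k) n)))
    ≈⟨ ∑-cong m (λ i i<m → *-congˡ (T-shift-δ k<n i<m)) ⟩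
  ∑[ i < m ] (nat (suc i) * u (suc i) * E k (n ∸ suc i)) ∎
  where
  m : ℕ
  m = suc (n ∸ suc k)

∂-E : ∀ {k n i} → suc k ≤ n → i < suc (n ∸ suc k) → ∂ (suc i) (E (suc k) n) ≈ E k (n ∸ suc i)
∂-E {k} {n} {i} k<n i<m = ≈-trans
  (∂-T (suc k) (suc (n ∸ suc k)) 0 i (δ-bounded (suc k) n ℕ.≤-refl) z≤n i<m) (T-shift-δ k<n i<m)

∂-B : ∀ {k n i} → suc k ≤ n → i < suc (n ∸ suc k) →
  ∂ (suc i) (B n (suc k) j!u) ≈ nat (n !) * E k (n ∸ suc i)
∂-B {k} {n} {i} k<n i<m = ≈-trans (∂-cong (suc i) (bell n (suc k)))
  (≈-trans (∂-con-* (suc i) _ _) (*-congˡ (∂-E k<n i<m)))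

-- Common source of both formulas: `suc n !` supplies the factor `suc n` that Euler's identity
-- consumes, and `n !` is left over.
B-euler : ∀ {k n} → k ≤ n →
  B (suc n) (suc k) j!u ≈ ∑[ i < suc (n ∸ k) ] (nat (n !) * (nat (suc i) * u (suc i) * E k (n ∸ i)))
B-euler {k} {n} k≤n = begin
  B (suc n) (suc k) j!u
    ≈⟨ bell (suc n) (suc k) ⟩
  nat (suc n !) * E (suc k) (suc n)
    ≈⟨ *-congʳ (nat-* (suc n) (n !)) ⟩
  nat (suc n) * nat (n !) * E (suc k) (suc n)
    ≈⟨ solve 3 (λ x y z → x :* y :* z := y :* (x :* z)) ≈-refl _ _ _ ⟩
  nat (n !) * (nat (suc n) * E (suc k) (suc n))
    ≈⟨ *-congˡ (E-euler (s≤s k≤n)) ⟩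
  nat (n !) * (∑[ i < suc (n ∸ k) ] (nat (suc i) * u (suc i) * E k (n ∸ i)))
    ≈⟨ ∑-*ˡ (suc (n ∸ k)) (nat (n !)) _ ⟩
  ∑[ i < suc (n ∸ k) ] (nat (n !) * (nat (suc i) * u (suc i) * E k (n ∸ i))) ∎

-- Falling factorials and the two recurrences.

nPk*[n∸k]!≡n! : ∀ {n k} → k ≤ n → (n P k) ℕ.* (n ∸ k) ! ≡ n !
nPk*[n∸k]!≡n! {n} {k} k≤n = ≡.trans (≡.cong (ℕ._* (n ∸ k) !) (nPk≡n!/[n∸k]! k≤n))
  (m/n*n≡m {{(n ∸ k) ℕ.!≢0}} (m≤n⇒m!∣n! (ℕ.m∸n≤m n k)))

-- The falling factorial completes the factor `(n ∸ j) !` of the smaller Bell polynomial to `n !`.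
B-falling : ∀ n k j → j ≤ n →
  nat (suc j) * nat (n P j) * u (suc j) * B (suc n ∸ j ∸ 1) k j!u ≈
  nat (n !) * (nat (suc j) * u (suc j) * E k (n ∸ j))
B-falling n k j j≤n = begin
  nat (suc j) * nat (n P j) * u (suc j) * B (suc n ∸ j ∸ 1) k j!u
    ≈⟨ *-congˡ (≈-trans (reflexive (≡.cong (λ t → B t k j!u) 1+n∸j∸1≡n∸j)) (bell (n ∸ j) k)) ⟩
  nat (suc j) * nat (n P j) * u (suc j) * (nat ((n ∸ j) !) * E k (n ∸ j))
    ≈⟨ solve 5 (λ x y z v w → x :* y :* z :* (v :* w) := y :* v :* (x :* z :* w)) ≈-refl _ _ _ _ _ ⟩
  nat (n P j) * nat ((n ∸ j) !) * (nat (suc j) * u (suc j) * E k (n ∸ j))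
    ≈⟨ *-congʳ (≈-trans (≈-sym (nat-* (n P j) ((n ∸ j) !))) (reflexive (≡.cong nat (nPk*[n∸k]!≡n! j≤n)))) ⟩
  nat (n !) * (nat (suc j) * u (suc j) * E k (n ∸ j)) ∎
  where
  1+n∸j∸1≡n∸j : suc n ∸ j ∸ 1 ≡ n ∸ j
  1+n∸j∸1≡n∸j = ≡.cong (_∸ 1) (ℕ.+-∸-assoc 1 j≤n)

corollary2p4 : (n : ℕ) → 1 ≤ n →
    ((k : ℕ) → 2 ≤ k → k ≤ n →
    B n k j!u ≈
    ∑[ j ∈ 0 ⋯ n ∸ k ]
    (nat (suc j) * nat ((n ∸ 1) P j) * u (suc j) * B (n ∸ j ∸ 1) (k ∸ 1) j!u))
    ×
    ((k : ℕ) → 2 ≤ k → k ≤ n ∸ 1 →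
    B n k j!u ≈
    u 1 * B (n ∸ 1) (k ∸ 1) j!u
    + (∑[ j ∈ 1 ⋯ n ∸ k ]
    (nat (suc j) * u (suc j) * ∂ j (B (n ∸ 1) k j!u))))
corollary2p4 (suc n) _ = first , second
  where
  first : ∀ k → 2 ≤ k → k ≤ suc n →
    B (suc n) k j!u ≈
    ∑[ j ∈ 0 ⋯ suc n ∸ k ] (nat (suc j) * nat (n P j) * u (suc j) * B (suc n ∸ j ∸ 1) (k ∸ 1) j!u)
  first (suc k) _ (s≤s k≤n) = ≈-trans (B-euler k≤n) (≈-sym (≈-trans (sum≈∑ (suc (n ∸ k)) _)
    (∑-cong (suc (n ∸ k)) λ { j (s≤s j≤n∸k) → B-falling n k j (ℕ.≤-trans j≤n∸k (ℕ.m∸n≤m n k)) })))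

  second : ∀ k → 2 ≤ k → k ≤ n →
    B (suc n) k j!u ≈
    u 1 * B n (k ∸ 1) j!u + (∑[ j ∈ 1 ⋯ suc n ∸ k ] (nat (suc j) * u (suc j) * ∂ j (B n k j!u)))
  -- The head of the Euler sum is the `u 1` term; the `n ∸ k` others are matched with derivatives.
  second (suc k) _ k<n = ≈-trans (B-euler (ℕ.<⇒≤ k<n)) (≈-trans (∑-head (n ∸ k) _) (+-cong
    (begin
      nat (n !) * (nat 1 * u 1 * E k n)
        ≈⟨ solve 4 (λ x y z w → x :* (y :* z :* w) := z :* (y :* (x :* w))) ≈-refl _ _ _ _ ⟩
      u 1 * (con 1ℚ * (nat (n !) * E k n))
        ≈⟨ *-congˡ (≈-trans (*-idˡ _) (≈-sym (bell n k))) ⟩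
      u 1 * B n k j!u ∎)
    (≈-sym (≈-trans (sum≈∑ (n ∸ k) _) (∑-cong (n ∸ k) λ i i<n∸k → begin
      nat (suc (suc i)) * u (suc (suc i)) * ∂ (suc i) (B n (suc k) j!u)
        -- Differentiating by `u (suc i)` yields the same `E k (n ∸ suc i)` that the Euler sum
        -- attaches to `u (suc (suc i))`.
        ≈⟨ *-congˡ (∂-B k<n (≡.subst (i <_) (ℕ.+-∸-assoc 1 k<n) i<n∸k)) ⟩
      nat (suc (suc i)) * u (suc (suc i)) * (nat (n !) * E k (n ∸ suc i))
        ≈⟨ solve 3 (λ x y z → x :* (y :* z) := y :* (x :* z)) ≈-refl _ _ _ ⟩
      nat (n !) * (nat (suc (suc i)) * u (suc (suc i)) * E k (n ∸ suc i)) ∎)))))
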